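{- For every integer $n\ge 1$, $|\mathcal{S}_n(32;\,2\to 1)| = B_n$, where $B_n$ is the $n$-th Bell number.
   Context: $[n]=\{1,\dots,n\}$, and $\mathcal{S}_n$ is the set of permutations $\pi=\pi_1\pi_2\cdots\pi_n$ of $[n]$ in one-line notation. The permutation $\hat\pi$: for $\pi\in\mathcal{S}_n$, $\hat\pi\in\mathcal{S}_n$ is the permutation whose cycle form is obtained from the word $\pi_1\cdots\pi_n$ by inserting a left parenthesis before each left-to-right maximum (an entry larger than all entries to its left) and a right parenthesis immediately before the next left-to-right maximum, or at the end of the word. A cycle $(c_1,c_2,\dots,c_s)$ means $c_1\mapsto c_2\mapsto\cdots\mapsto c_s\mapsto c_1$. Example: if $\pi=2537164$ then $\hat\pi=(2)(53)(7164)$. Arrow patterns: an arrow pattern of size $k$ is a pair $(\nu;H)$ where $\nu=\nu_1\cdots\nu_m$ is a word of distinct positive integers, $H$ is a collection of arrows $b_i\to c_i$, and the set of all integers appearing in $\nu$ or $H$ is $[k]$. A permutation $\pi\in\mathcal{S}_n$ contains $(\nu;H)$ if there are a set $X=\{x_1<x_2<\cdots<x_k\}\subseteq[n]$ and indices $t_1<\cdots<t_m$ such that $\pi_{t_1}\pi_{t_2}\cdots\pi_{t_m}=x_{\nu_1}x_{\nu_2}\cdots x_{\nu_m}$ and $\hat\pi(x_{b_i})=x_{c_i}$ for every arrow $b_i\to c_i$ in $H$. Otherwise $\pi$ avoids $(\nu;H)$. $\mathcal{S}_n(\nu;H)$ is the set of permutations in $\mathcal{S}_n$ avoiding $(\nu;H)$.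 The Bell number $B_n$ is the number of set partitions of $[n]$. -}

module Defs where

open import Data.Fin using (Fin; _<_; _<?_)
open import Data.Fin.Patterns using (0F; 1F; 2F)
open import Data.Fin.Permutation using (Permutation′; _⟨$⟩ʳ_)
import Data.Fin.Properties as Fin
open import Data.Fin.Subset using (Subset; Nonempty; Empty; _∈_; _∩_; inside; outside)
open import Data.Fin.Subset.Properties using (_∈?_; nonempty?)
open import Data.List using (List; []; _∷_; _++_; map; filter; foldr; length; tabulate)
open import Data.List.Relation.Unary.All using (All; all?)
open import Data.List.Relation.Unary.AllPairs using (AllPairs; allPairs?)
open import Data.List.Relation.Unary.Any using (Any; here; any?)
open import Data.Nat using (ℕ; zero; suc)
open import Data.Product using (Σ-syntax; _×_; _,_)
open import Data.Sum using (_⊎_; inj₁; inj₂)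
open import Data.Vec as Vec using (Vec; lookup)
import Data.Vec.Membership.Propositional as Vec
open import Data.Vec.Relation.Unary.All using ([]; _∷_)
open import Data.Vec.Relation.Unary.AllPairs using ([]; _∷_)
import Data.Vec.Relation.Unary.Any as VecAny
open import Data.Vec.Relation.Unary.Unique.Propositional using (Unique)
open import Function.Bundles using (Inverse)
open import Level using (0ℓ)
open import Relation.Binary using (Setoid; _Preserves_⟶_)
import Relation.Binary.Construct.On as On
open import Relation.Binary.PropositionalEquality
  using (_≡_; refl; setoid; _→-setoid_)
open import Relation.Nullary using (Dec; yes; no; ¬_; ¬?; _×-dec_)

-- Throughout, [n] = {1,…,n} is represented by Fin n, so that the integer i
-- corresponds to the element of Fin n with value i - 1.

HasCardinality : Setoid 0ℓ 0ℓ → ℕ → Set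
HasCardinality S k = Inverse S (setoid (Fin k))

------------------------------------------------------------------------
-- The permutation π̂

-- One-line notation: π ⟨$⟩ʳ i is the entry π_{i+1}.
word : ∀ {n} → Permutation′ n → List (Fin n)
word π = tabulate (π ⟨$⟩ʳ_)

-- splitAtMaxima m w, where m is the largest entry read so far, consists of
-- the entries of w that complete the cycle currently open, followed by the
-- list of cycles opened in w.
splitAtMaxima : ∀ {n} → Fin n → List (Fin n) → List (Fin n) × List (List (Fin n))
splitAtMaxima m [] = [] , []
splitAtMaxima m (x ∷ w) with m <? x
... | yes _ = let c , cs = splitAtMaxima x w in [] , (x ∷ c) ∷ cs
... | no  _ = let c , cs = splitAtMaxima m w in (x ∷ c) , cs

cycles : ∀ {n} → List (Fin n) → List (List (Fin n))
cycles []      = []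
cycles (x ∷ w) = let c , cs = splitAtMaxima x w in (x ∷ c) ∷ cs

-- applyCycle₁ f c x is the image of x, where c is a final segment of a cycle
-- that starts with f.  An x not listed in c is left fixed.
applyCycle₁ : ∀ {n} → Fin n → List (Fin n) → Fin n → Fin n
applyCycle₁ f []      x = x
applyCycle₁ f (a ∷ c) x with x Fin.≟ a
applyCycle₁ f (a ∷ [])    x | yes _ = f
applyCycle₁ f (a ∷ b ∷ c) x | yes _ = b
applyCycle₁ f (a ∷ c)     x | no  _ = applyCycle₁ f c x

applyCycle : ∀ {n} → List (Fin n) → Fin n → Fin n
applyCycle []      x = x
applyCycle (f ∷ c) x = applyCycle₁ f (f ∷ c) x

-- The product of the cycles; they are disjoint, so the order is immaterial.
hat : ∀ {n} → Permutation′ n → Fin n → Fin n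
hat π x = foldr applyCycle x (cycles (word π))

------------------------------------------------------------------------
-- Arrow patterns

record ArrowPattern (k : ℕ) : Set where
  field
    {m}      : ℕ
    ν        : Vec (Fin k) m
    H        : List (Fin k × Fin k)    -- (b , c) is the arrow b → c
    distinct : Unique ν
    covers   : ∀ j → (j Vec.∈ ν) ⊎ Any (λ (b , c) → (j ≡ b) ⊎ (j ≡ c)) H

Contains : ∀ {n k} → Permutation′ n → ArrowPattern k → Set
Contains {n} {k} π p =
  Σ[ x ∈ (Fin k → Fin n) ] Σ[ t ∈ (Fin m → Fin n) ]
    (x Preserves _<_ ⟶ _<_) ×
    (t Preserves _<_ ⟶ _<_) ×
    (∀ j → π ⟨$⟩ʳ t j ≡ x (lookup ν j)) ×
    All (λ (b , c) → hat π (x b) ≡ x c) H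
  where open ArrowPattern p

Avoids : ∀ {n k} → Permutation′ n → ArrowPattern k → Set
Avoids π p = ¬ Contains π p

-- 𝒮ₙ(ν;H), with permutations identified when they agree pointwise.
𝒮 : ∀ n {k} → ArrowPattern k → Setoid 0ℓ 0ℓ
𝒮 n p = On.setoid {B = Σ[ π ∈ Permutation′ n ] Avoids π p}
                  (Fin n →-setoid Fin n) (λ (π , _) → π ⟨$⟩ʳ_)

-- (32; 2→1)
32,2→1 : ArrowPattern 3
32,2→1 = record
  { ν        = 2F Vec.∷ 1F Vec.∷ Vec.[]
  ; H        = (1F , 0F) ∷ []
  ; distinct = ((λ ()) ∷ []) ∷ [] ∷ []
  ; covers   = λ { 0F → inj₂ (here (inj₂ refl))
                 ; 1F → inj₁ (VecAny.there (VecAny.here refl))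
                 ; 2F → inj₁ (VecAny.here refl) }
  }

------------------------------------------------------------------------
-- Bell numbers

sublists : ∀ {A : Set} → List A → List (List A)
sublists []       = [] ∷ []
sublists (x ∷ xs) = sublists xs ++ map (x ∷_) (sublists xs)

subsets : ∀ n → List (Subset n)
subsets zero    = Vec.[] ∷ []
subsets (suc n) = map (outside Vec.∷_) (subsets n) ++ map (inside Vec.∷_) (subsets n)

IsSetPartition : ∀ {n} → List (Subset n) → Set
IsSetPartition F =
  All Nonempty F ×
  AllPairs (λ p q → Empty (p ∩ q)) F ×
  (∀ i → Any (i ∈_) F)

isSetPartition? : ∀ {n} (F : List (Subset n)) → Dec (IsSetPartition F)
isSetPartition? F =
  all? nonempty? F ×-dec
  allPairs? (λ p q → ¬? (nonempty? (p ∩ q))) F ×-dec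
  Fin.all? (λ i → any? (i ∈?_) F)

-- subsets n lists every subset of [n] exactly once, so its sublists are the
-- families of subsets of [n], each occurring exactly once.
setPartitions : ∀ n → List (List (Subset n))
setPartitions n = filter isSetPartition? (sublists (subsets n))

bell : ℕ → ℕ
bell n = length (setPartitions n)

{-# OPTIONS --safe #-}

-- If π̂(x) = y < x then x is not last in its cycle, because the last entry is
-- mapped to the maximum of the cycle; so y follows x in the word.  Hence π
-- avoids (32; 2→1) iff every descent top is a left-to-right maximum, that is,
-- iff every cycle of π̂ is written as its maximum followed by its other
-- elements in increasing order.  Such a π is determined by the partition of
-- [n] into the cycles of π̂, and every partition arises.  Both sides are
-- identified with the maps sending each element to the maximum of its block,
-- i.e. the idempotent maps r with i ≤ r i.

module Submission where

open import Defs
open import Data.Nat using (ℕ; _≥_)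

import Data.Bool.Properties as Bool
open import Data.Fin
  using (Fin; zero; suc; toℕ; fromℕ<; inject₁; punchOut; _<_; _≤_; _<?_; _≤?_)
open import Data.Fin.Induction using (<-weakInduction)
open import Data.Fin.Patterns using (0F; 1F; 2F)
open import Data.Fin.Permutation
  using (Permutation′; permutation; flip; _⟨$⟩ʳ_; _⟨$⟩ˡ_; inverseˡ; inverseʳ)
import Data.Fin.Properties as Fin
open import Data.Fin.Subset using (Subset; inside; outside; Empty; ∣_∣; _∩_; _⊂_)
  renaming (_∈_ to _∈ₛ_)
open import Data.Fin.Subset.Properties
  using (_∈?_; ∈⊤; ∣⊤∣≡n; ⊆-antisym; p⊂q⇒∣p∣<∣q∣; x∈p∩q⁺; x∈p∩q⁻)
open import Data.List
  using (List; []; _∷_; _++_; concat; filter; foldr; lookup; map; tabulate)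
open import Data.List.Membership.Propositional using (_∈_; _∉_; find; lose)
open import Data.List.Membership.Propositional.Properties
  using ( ∈-++⁺ˡ; ∈-++⁺ʳ; ∈-++⁻; ∈-concat⁺′; ∈-concat⁻′; ∈-filter⁺; ∈-filter⁻
        ; ∈-lookup; ∈-map⁺; ∈-map⁻; ∈-tabulate⁺; ∈-AllPairs₂ )
open import Data.List.Relation.Binary.Disjoint.Propositional using (Disjoint)
import Data.List.Relation.Binary.Subset.Propositional as List
open import Data.List.Relation.Unary.All as All using (All; []; _∷_)
import Data.List.Relation.Unary.All.Properties as All
open import Data.List.Relation.Unary.AllPairs using (AllPairs; []; _∷_)
open import Data.List.Relation.Unary.Any as Any using (Any; here; there; any?; index)
open import Data.List.Relation.Unary.Any.Properties using (lookup-index)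
open import Data.List.Relation.Unary.Unique.Propositional using (Unique)
open import Data.List.Relation.Unary.Unique.Propositional.Properties
  using (++⁺; map⁺; filter⁺; tabulate⁺; Unique[x∷xs]⇒x∉xs)
open import Data.Nat as ℕ using (zero; suc; z<s; s<s; s≤s; z≤n)
import Data.Nat.Properties as ℕ
open import Data.Product
  using (Σ-syntax; ∃; ∃-syntax; ∃₂; _×_; _,_; proj₁; proj₂; swap; map₂)
open import Data.Sum using (_⊎_; inj₁; inj₂; map₁)
open import Data.Unit using (⊤)
open import Data.Vec as Vec using ()
import Data.Vec.Properties as Vec
open import Function using (_∘_; id)
open import Function.Bundles using (Inverse)
import Function.Construct.Composition as Composition
open import Level using (0ℓ)
open import Relation.Binary
  using ( Rel; Setoid; Irreflexive; Transitive; Trichotomous; tri<; tri≈; tri>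
        ; IsStrictTotalOrder; _Preserves_⟶_ )
import Relation.Binary.Construct.On as On
open import Relation.Binary.PropositionalEquality
  using ( _≡_; _≢_; _≗_; refl; sym; trans; cong; subst; subst₂; resp₂; setoid
        ; isEquivalence; _→-setoid_ )
open import Relation.Nullary using (¬_; yes; no; does; contradiction; _×-dec_)
open import Relation.Nullary.Decidable using (dec-true)
open import Relation.Unary using (Pred; Decidable)

private
  variable
    n : ℕ
    A : Set

-- Consecutive entries of a list, and lists without repetition.

data Adjacent {A : Set} (x y : A) : List A → Set where
  here  : ∀ {w} → Adjacent x y (x ∷ y ∷ w)
  there : ∀ {z w} → Adjacent x y w → Adjacent x y (z ∷ w)

adjacent-∈ˡ : ∀ {x y : A} {w} → Adjacent x y w → x ∈ w
adjacent-∈ˡ here      = here refl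
adjacent-∈ˡ (there a) = there (adjacent-∈ˡ a)

adjacent-∈ʳ : ∀ {x y : A} {w} → Adjacent x y w → y ∈ w
adjacent-∈ʳ here      = there (here refl)
adjacent-∈ʳ (there a) = there (adjacent-∈ʳ a)

adjacent-++⁺ˡ : ∀ {x y : A} {v w} → Adjacent x y v → Adjacent x y (v ++ w)
adjacent-++⁺ˡ here      = here
adjacent-++⁺ˡ (there a) = there (adjacent-++⁺ˡ a)

adjacent-++⁺ʳ : ∀ {x y : A} v {w} → Adjacent x y w → Adjacent x y (v ++ w)
adjacent-++⁺ʳ []      a = a
adjacent-++⁺ʳ (_ ∷ v) a = there (adjacent-++⁺ʳ v a)

adjacent-concat⁺ : ∀ {x y : A} {c cs} → c ∈ cs → Adjacent x y c → Adjacent x y (concat cs)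
adjacent-concat⁺ (here refl)              a = adjacent-++⁺ˡ a
adjacent-concat⁺ (there {x = d} c∈cs) a = adjacent-++⁺ʳ d (adjacent-concat⁺ c∈cs a)

unique-++⁻ : ∀ (v : List A) {w} → Unique (v ++ w) → Unique v × Unique w × Disjoint v w
unique-++⁻ []      u       = [] , u , λ { (() , _) }
unique-++⁻ (x ∷ v) (p ∷ u) with uv , uw , d ← unique-++⁻ v u =
  All.++⁻ˡ v p ∷ uv , uw ,
  λ { (here refl , x∈w) → All.lookup p (∈-++⁺ʳ v x∈w) refl
    ; (there z∈v , z∈w) → d (z∈v , z∈w) }

-- Cycles and π̂

applyCycle₁-∉ : ∀ (f : Fin n) c {x} → x ∉ c → applyCycle₁ f c x ≡ x
applyCycle₁-∉ f []          x∉c = refl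
applyCycle₁-∉ f (a ∷ c) {x} x∉c with x Fin.≟ a
applyCycle₁-∉ f (a ∷ c)     x∉c | yes refl = contradiction (here refl) x∉c
applyCycle₁-∉ f (a ∷ [])    x∉c | no _     = refl
applyCycle₁-∉ f (a ∷ b ∷ c) x∉c | no _     = applyCycle₁-∉ f (b ∷ c) (x∉c ∘ there)

-- The right alternative is the wrap-around at the last entry of the segment.
applyCycle₁-adjacent : ∀ (f : Fin n) c {x} → x ∈ c →
                       Adjacent x (applyCycle₁ f c x) c ⊎ applyCycle₁ f c x ≡ f
applyCycle₁-adjacent f (a ∷ [])    {x} x∈c with x Fin.≟ a
... | yes refl = inj₂ refl
applyCycle₁-adjacent f (a ∷ [])    {x} (here x≡a) | no x≢a = contradiction x≡a x≢a
applyCycle₁-adjacent f (a ∷ b ∷ c) {x} x∈c with x Fin.≟ a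
... | yes refl = inj₁ here
applyCycle₁-adjacent f (a ∷ b ∷ c) {x} (here x≡a) | no x≢a = contradiction x≡a x≢a
applyCycle₁-adjacent f (a ∷ b ∷ c) {x} (there x∈c) | no _
  with applyCycle₁-adjacent f (b ∷ c) x∈c
... | inj₁ p = inj₁ (there p)
... | inj₂ q = inj₂ q

adjacent⇒applyCycle₁ : ∀ (f : Fin n) {c x y} → Unique c → Adjacent x y c →
                       applyCycle₁ f c x ≡ y
adjacent⇒applyCycle₁ f {a ∷ b ∷ c} {x} u here with x Fin.≟ a
... | yes _  = refl
... | no x≢x = contradiction refl x≢x
adjacent⇒applyCycle₁ f {a ∷ b ∷ c} {x} (a≢ ∷ u) (there p) with x Fin.≟ a
... | yes refl = contradiction refl (All.lookup a≢ (adjacent-∈ˡ p))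
... | no _     = adjacent⇒applyCycle₁ f u p

adjacent⇒applyCycle : ∀ {c} {x y : Fin n} → Unique c → Adjacent x y c → applyCycle c x ≡ y
adjacent⇒applyCycle {c = f ∷ c} = adjacent⇒applyCycle₁ f

applyCycle-∉ : ∀ c {x : Fin n} → x ∉ c → applyCycle c x ≡ x
applyCycle-∉ []      x∉c = refl
applyCycle-∉ (f ∷ c) x∉c = applyCycle₁-∉ f (f ∷ c) x∉c

applyCycle-∈ : ∀ c {x : Fin n} → x ∈ c → applyCycle c x ∈ c
applyCycle-∈ (f ∷ c) x∈c with applyCycle₁-adjacent f (f ∷ c) x∈c
... | inj₁ a  = adjacent-∈ʳ a
... | inj₂ eq = here eq

product-∉ : ∀ cs {x : Fin n} → x ∉ concat cs → foldr applyCycle x cs ≡ x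
product-∉ []       x∉ = refl
product-∉ (c ∷ cs) x∉ =
  trans (cong (applyCycle c) (product-∉ cs (x∉ ∘ ∈-++⁺ʳ c))) (applyCycle-∉ c (x∉ ∘ ∈-++⁺ˡ))

-- The cycles are disjoint: those applied before `c` fix `x`, and those applied after it fix
-- `applyCycle c x`, which lies in `c` again.
product-∈ : ∀ cs {c} {x : Fin n} → Unique (concat cs) → c ∈ cs → x ∈ c →
            foldr applyCycle x cs ≡ applyCycle c x
product-∈ (c ∷ cs) u (here refl) x∈c with _ , _ , d ← unique-++⁻ c u =
  cong (applyCycle c) (product-∉ cs (λ x∈cs → d (x∈c , x∈cs)))
product-∈ (d ∷ cs) {c} {x} u (there c∈cs) x∈c with _ , u′ , disj ← unique-++⁻ d u =
  trans (cong (applyCycle d) (product-∈ cs u′ c∈cs x∈c))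
        (applyCycle-∉ d (λ y∈d → disj (y∈d , ∈-concat⁺′ (applyCycle-∈ c x∈c) c∈cs)))

unique-concat⁻ : ∀ {cs} {c : List A} → Unique (concat cs) → c ∈ cs → Unique c
unique-concat⁻ {cs = c ∷ cs} u (here refl)  = proj₁ (unique-++⁻ c u)
unique-concat⁻ {cs = c ∷ cs} u (there c∈cs) =
  unique-concat⁻ (proj₁ (proj₂ (unique-++⁻ c u))) c∈cs

splitAtMaxima-concat : ∀ (m : Fin n) w → let c , cs = splitAtMaxima m w in c ++ concat cs ≡ w
splitAtMaxima-concat m []      = refl
splitAtMaxima-concat m (x ∷ w) with m <? x
... | yes _ = cong (x ∷_) (splitAtMaxima-concat x w)
... | no  _ = cong (x ∷_) (splitAtMaxima-concat m w)

cycles-concat : ∀ (w : List (Fin n)) → concat (cycles w) ≡ w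
cycles-concat []      = refl
cycles-concat (x ∷ w) = cong (x ∷_) (splitAtMaxima-concat x w)

MaxFirst : List (Fin n) → Set
MaxFirst []      = ⊤
MaxFirst (f ∷ c) = All (_≤ f) c

-- An entry joins the open cycle only if it does not exceed the running maximum `m`, and `m` is the
-- entry that opened this cycle.
splitAtMaxima-maxFirst : ∀ (m : Fin n) w →
                         let c , cs = splitAtMaxima m w in All (_≤ m) c × All MaxFirst cs
splitAtMaxima-maxFirst m []      = [] , []
splitAtMaxima-maxFirst m (x ∷ w) with m <? x
... | yes _  = let p , q = splitAtMaxima-maxFirst x w in [] , p ∷ q
... | no m≮x = let p , q = splitAtMaxima-maxFirst m w in ℕ.≮⇒≥ m≮x ∷ p , q

cycles-maxFirst : ∀ (w : List (Fin n)) → All MaxFirst (cycles w)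
cycles-maxFirst []      = []
cycles-maxFirst (x ∷ w) = let p , q = splitAtMaxima-maxFirst x w in p ∷ q

-- p is the entry read just before w; its cycle is still open.
splitAtMaxima-descent : ∀ {p m : Fin n} w {x y} → p ≤ m → Adjacent x y (p ∷ w) → y < x →
                        let c , cs = splitAtMaxima m w in Any (Adjacent x y) ((p ∷ c) ∷ cs)
splitAtMaxima-descent []      p≤m (there ())
splitAtMaxima-descent {m = m} (z ∷ w) p≤m a y<x with m <? z
splitAtMaxima-descent (z ∷ w) p≤m here      z<p | yes m<z =
  contradiction (ℕ.<-≤-trans z<p p≤m) (ℕ.<-asym m<z)
splitAtMaxima-descent (z ∷ w) p≤m (there a) y<x | yes _   =
  there (splitAtMaxima-descent w ℕ.≤-refl a y<x)
splitAtMaxima-descent (z ∷ w) p≤m here      z<p | no _    = here here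
splitAtMaxima-descent (z ∷ w) p≤m (there a) y<x | no m≮z
  with splitAtMaxima-descent w (ℕ.≮⇒≥ m≮z) a y<x
... | here b  = here (there b)
... | there b = there b

-- The lower entry of a descent is not a left-to-right maximum, so no cycle boundary separates it
-- from the entry before it.
cycles-descent : ∀ (w : List (Fin n)) {x y} → Adjacent x y w → y < x →
                 Any (Adjacent x y) (cycles w)
cycles-descent (z ∷ w) = splitAtMaxima-descent w ℕ.≤-refl

descent⇒product : ∀ (w : List (Fin n)) {x y} → Unique w → Adjacent x y w → y < x →
                  foldr applyCycle x (cycles w) ≡ y
descent⇒product w u a y<x
  with c , c∈cs , b ← find (cycles-descent w a y<x) =
  trans (product-∈ (cycles w) u′ c∈cs (adjacent-∈ˡ b))
        (adjacent⇒applyCycle (unique-concat⁻ u′ c∈cs) b)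
  where u′ = subst Unique (sym (cycles-concat w)) u

-- The only alternative is the wrap-around to the first entry `f`, which bounds every entry of the
-- cycle and so cannot lie below `x`.
applyCycle-descent : ∀ c {x y : Fin n} → MaxFirst c → x ∈ c → applyCycle c x ≡ y → y < x →
                     Adjacent x y c
applyCycle-descent (f ∷ c) c≤f x∈c refl y<x with applyCycle₁-adjacent f (f ∷ c) x∈c
... | inj₁ a   = a
... | inj₂ y≡f = contradiction (subst (_< _) y≡f y<x)
                               (ℕ.≤⇒≯ (All.lookup {P = _≤ f} (ℕ.≤-refl ∷ c≤f) x∈c))

product⇒descent : ∀ (w : List (Fin n)) {x y} → Unique w → x ∈ w →
                  foldr applyCycle x (cycles w) ≡ y → y < x → Adjacent x y w
product⇒descent w {x} u x∈w eq y<x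
  with c , x∈c , c∈cs ← ∈-concat⁻′ (cycles w) (subst (x ∈_) (sym (cycles-concat w)) x∈w) =
  subst (Adjacent x _) (cycles-concat w)
    (adjacent-concat⁺ c∈cs
      (applyCycle-descent c (All.lookup (cycles-maxFirst w) c∈cs) x∈c
        (trans (sym (product-∈ (cycles w) u′ c∈cs x∈c)) eq) y<x))
  where u′ = subst Unique (sym (cycles-concat w)) u

-- Descents of a permutation and the pattern (32; 2→1).

infix 4 _⋖_
_⋖_ : Fin n → Fin n → Set
i ⋖ j = suc (toℕ i) ≡ toℕ j

adjacent-tabulate⁺ : ∀ (f : Fin n → A) {i j} → i ⋖ j → Adjacent (f i) (f j) (tabulate f)
adjacent-tabulate⁺ f {zero}  {suc zero} refl = here
adjacent-tabulate⁺ f {suc i} {suc j}    i⋖j  =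
  there (adjacent-tabulate⁺ (f ∘ suc) (ℕ.suc-injective i⋖j))

adjacent-tabulate⁻ : ∀ (f : Fin n → A) {x y} → Adjacent x y (tabulate f) →
                     ∃₂ λ i j → i ⋖ j × f i ≡ x × f j ≡ y
adjacent-tabulate⁻ {n = suc (suc _)} f here      = zero , suc zero , refl , refl , refl
adjacent-tabulate⁻ {n = suc _}       f (there a)
  with i , j , i⋖j , p , q ← adjacent-tabulate⁻ (f ∘ suc) a =
  suc i , suc j , cong suc i⋖j , p , q

permutation-injective : ∀ (π : Permutation′ n) {i j} → π ⟨$⟩ʳ i ≡ π ⟨$⟩ʳ j → i ≡ j
permutation-injective π eq = trans (sym (inverseˡ π)) (trans (cong (π ⟨$⟩ˡ_) eq) (inverseˡ π))

word-unique : ∀ (π : Permutation′ n) → Unique (word π)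
word-unique π = tabulate⁺ (permutation-injective π)

descent⇒hat : ∀ (π : Permutation′ n) {i j} → i ⋖ j → π ⟨$⟩ʳ j < π ⟨$⟩ʳ i →
              hat π (π ⟨$⟩ʳ i) ≡ π ⟨$⟩ʳ j
descent⇒hat π i⋖j =
  descent⇒product (word π) (word-unique π) (adjacent-tabulate⁺ (π ⟨$⟩ʳ_) i⋖j)

hat⇒descent : ∀ (π : Permutation′ n) i {y} → hat π (π ⟨$⟩ʳ i) ≡ y → y < π ⟨$⟩ʳ i →
              ∃[ j ] i ⋖ j × π ⟨$⟩ʳ j ≡ y
hat⇒descent π i eq y<x
  with i′ , j , i⋖j , p , q ← adjacent-tabulate⁻ (π ⟨$⟩ʳ_)
         (product⇒descent (word π) (word-unique π) (∈-tabulate⁺ i) eq y<x)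
  with refl ← permutation-injective π p =
  j , i⋖j , q

DescentTopsAreRecords : (Fin n → Fin n) → Set
DescentTopsAreRecords f = ∀ {i j k} → i ⋖ j → f j < f i → k < i → f k ≤ f i

-- A larger entry at `k`, before a descent from `i` to `j`, would complete an occurrence: the values
-- are those at `j`, `i`, `k` in increasing order, the word 32 sits at positions `k < i`, and
-- `descent⇒hat` supplies the arrow.
avoids⇒descentTopsAreRecords : ∀ (π : Permutation′ n) → Avoids π 32,2→1 →
                               DescentTopsAreRecords (π ⟨$⟩ʳ_)
avoids⇒descentTopsAreRecords π av {i} {j} {k} i⋖j πj<πi k<i = ℕ.≮⇒≥ λ πi<πk →
  av ( (λ { 0F → π ⟨$⟩ʳ j ; 1F → π ⟨$⟩ʳ i ; 2F → π ⟨$⟩ʳ k })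
     , (λ { 0F → k ; 1F → i })
     , (λ { {0F} {1F} _ → πj<πi
          ; {0F} {2F} _ → ℕ.<-trans πj<πi πi<πk
          ; {1F} {2F} _ → πi<πk
          ; {1F} {1F} (s<s ())
          ; {2F} {1F} (s<s ())
          ; {2F} {2F} (s<s (s<s ())) })
     , (λ { {0F} {1F} _ → k<i
          ; {1F} {1F} (s<s ()) })
     , (λ { 0F → refl ; 1F → refl })
     , descent⇒hat π i⋖j πj<πi ∷ [] )

-- The arrow goes to a smaller value, so its target is the entry right after position `t 1F`. Thus
-- `x 1F` is a descent top, yet the larger `x 2F` stands to its left.
descentTopsAreRecords⇒avoids : ∀ (π : Permutation′ n) → DescentTopsAreRecords (π ⟨$⟩ʳ_) →
                               Avoids π 32,2→1
descentTopsAreRecords⇒avoids π records (x , t , x-mono , t-mono , occ , arrow ∷ [])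
  with j , i⋖j , eq ← hat⇒descent π (t 1F) (trans (cong (hat π) (occ 1F)) arrow)
         (subst (x 0F <_) (sym (occ 1F)) (x-mono z<s)) =
  ℕ.<⇒≱ (x-mono {1F} {2F} (s<s z<s))
    (subst₂ _≤_ (occ 0F) (occ 1F)
      (records i⋖j (subst₂ _<_ (sym eq) (sym (occ 1F)) (x-mono {0F} {1F} z<s)) (t-mono z<s)))

-- Greatest elements of decidable predicates.

IsGreatest : Pred (Fin n) 0ℓ → Fin n → Set
IsGreatest P m = P m × (∀ {k} → P k → k ≤ m)

-- Two equivalent predicates are allowed, so that this also compares leaders of pointwise equal
-- permutations and maxima of one block reached from two of its elements.
greatest-unique : ∀ {P Q : Pred (Fin n) 0ℓ} {l m} → (∀ {k} → P k → Q k) → (∀ {k} → Q k → P k) →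
                  IsGreatest P l → IsGreatest Q m → l ≡ m
greatest-unique P⊆Q Q⊆P (Pl , ub) (Qm , ub′) = Fin.≤-antisym (ub′ (P⊆Q Pl)) (ub (Q⊆P Qm))

greatest : ∀ {P : Pred (Fin n) 0ℓ} → Decidable P → ∃ P → ∃ (IsGreatest P)
greatest {n = suc n} {P} P? (i , Pi) with Fin.any? (P? ∘ suc)
... | yes P∘suc with m , Pm , ub ← greatest (P? ∘ suc) P∘suc =
  suc m , Pm , λ { {zero} _ → z≤n ; {suc k} Pk → s≤s (ub Pk) }
... | no ¬P∘suc with i
...   | zero  = zero , Pi , λ { {zero} _ → z≤n ; {suc k} Pk → contradiction (k , Pk) ¬P∘suc }
...   | suc k = contradiction (k , Pi) ¬P∘suc

-- Sorting [n] by a strict total order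

subsetOf : ∀ {P : Pred (Fin n) 0ℓ} → Decidable P → Subset n
subsetOf P? = Vec.tabulate (does ∘ P?)

∈-subsetOf⁺ : ∀ {P : Pred (Fin n) 0ℓ} (P? : Decidable P) {x} → P x → x ∈ₛ subsetOf P?
∈-subsetOf⁺ P? {x} Px =
  Vec.lookup⇒[]= x _ (trans (Vec.lookup∘tabulate (does ∘ P?) x) (dec-true (P? x) Px))

∈-subsetOf⁻ : ∀ {P : Pred (Fin n) 0ℓ} (P? : Decidable P) {x} → x ∈ₛ subsetOf P? → P x
∈-subsetOf⁻ P? {x} x∈ with P? x in eq
... | yes Px = Px
... | no ¬Px with () ← trans (sym (Vec.[]=⇒lookup x∈))
                             (trans (Vec.lookup∘tabulate (does ∘ P?) x) (cong does eq))

-- A value `j` outside the image could be punched out, leaving an injection into a set with one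
-- element fewer.
injective⇒surjective : ∀ {f : Fin n → Fin n} → (∀ {i j} → f i ≡ f j → i ≡ j) →
                       ∀ j → ∃[ i ] f i ≡ j
injective⇒surjective {n = suc n} {f} inj j with Fin.any? (λ i → f i Fin.≟ j)
... | yes p = p
... | no ¬p = contradiction
  (Fin.injective⇒≤ {f = punchOut ∘ j≢f} (inj ∘ Fin.punchOut-injective (j≢f _) (j≢f _)))
  ℕ.1+n≰n
  where
  j≢f : ∀ i → j ≢ f i
  j≢f i j≡fi = ¬p (i , sym j≡fi)

module _ {_≺_ : Rel (Fin n) 0ℓ} (isSTO : IsStrictTotalOrder _≡_ _≺_) where
  open IsStrictTotalOrder isSTO using (compare; irrefl; asym)
    renaming (trans to ≺-trans; _<?_ to _≺?_)

  -- The size of this set is the 0-based position of `x` in the order; it is less than `n` because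
  -- `x` itself is missing.
  below : Fin n → Subset n
  below x = subsetOf (λ y → y ≺? x)

  below-⊂ : ∀ {x y} → x ≺ y → below x ⊂ below y
  below-⊂ {x} x≺y =
    (λ z∈ → ∈-subsetOf⁺ (_≺? _) (≺-trans (∈-subsetOf⁻ (_≺? _) z∈) x≺y)) ,
    x , ∈-subsetOf⁺ (_≺? _) x≺y , λ x∈ → irrefl refl (∈-subsetOf⁻ (_≺? _) x∈)

  ∣below∣<n : ∀ x → ∣ below x ∣ ℕ.< n
  ∣below∣<n x = subst (∣ below x ∣ ℕ.<_) (∣⊤∣≡n n)
    (p⊂q⇒∣p∣<∣q∣ ((λ _ → ∈⊤) , x , ∈⊤ , λ x∈ → irrefl refl (∈-subsetOf⁻ (_≺? _) x∈)))

  rank : Fin n → Fin n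
  rank x = fromℕ< (∣below∣<n x)

  rank-mono : rank Preserves _≺_ ⟶ _<_
  rank-mono x≺y = subst₂ ℕ._<_ (sym (Fin.toℕ-fromℕ< _)) (sym (Fin.toℕ-fromℕ< _))
                               (p⊂q⇒∣p∣<∣q∣ (below-⊂ x≺y))

  rank-injective : ∀ {x y} → rank x ≡ rank y → x ≡ y
  rank-injective {x} {y} eq with compare x y
  ... | tri< x≺y _ _ = contradiction (rank-mono x≺y) (Fin.<-irrefl eq)
  ... | tri≈ _ x≡y _ = x≡y
  ... | tri> _ _ y≺x = contradiction (rank-mono y≺x) (Fin.<-irrefl (sym eq))

  rank-surjective : ∀ i → ∃[ x ] rank x ≡ i
  rank-surjective = injective⇒surjective rank-injective

  -- Position `i` holds the element of rank `i`, so the forward map is the inverse of `rank`.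
  sort : Permutation′ n
  sort = permutation (proj₁ ∘ rank-surjective) rank
           (λ x → rank-injective (proj₂ (rank-surjective (rank x))))
           (proj₂ ∘ rank-surjective)

  sort-mono : (sort ⟨$⟩ʳ_) Preserves _<_ ⟶ _≺_
  sort-mono {i} {j} i<j with compare (sort ⟨$⟩ʳ i) (sort ⟨$⟩ʳ j)
  ... | tri< p _ _  = p
  ... | tri≈ _ eq _ = contradiction i<j (Fin.<-irrefl (permutation-injective sort eq))
  ... | tri> _ _ q  = contradiction i<j (ℕ.<-asym
    (subst₂ _<_ (proj₂ (rank-surjective j)) (proj₂ (rank-surjective i)) (rank-mono q)))

  -- Some j ≤ i has i ≤ ρ⁻¹ (π j), so that ρ i ≼ π j ≼ π i.
  sorted-minimal : ∀ (π ρ : Permutation′ n) → (π ⟨$⟩ʳ_) Preserves _<_ ⟶ _≺_ →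
                   (ρ ⟨$⟩ʳ_) Preserves _<_ ⟶ _≺_ → ∀ i → ¬ (π ⟨$⟩ʳ i) ≺ (ρ ⟨$⟩ʳ i)
  sorted-minimal π ρ π-mono ρ-mono i πi≺ρi
    with j , j≤i , i≤k ← Fin.injective⇒existsPivot {f = (ρ ⟨$⟩ˡ_) ∘ (π ⟨$⟩ʳ_)}
           (permutation-injective π ∘ permutation-injective (flip ρ)) i
    = no-pivot (ℕ.m≤n⇒m<n∨m≡n j≤i) (ℕ.m≤n⇒m<n∨m≡n i≤k)
    where
    πj≺ρi : ∀ {j} → j < i ⊎ toℕ j ≡ toℕ i → (π ⟨$⟩ʳ j) ≺ (ρ ⟨$⟩ʳ i)
    πj≺ρi (inj₁ j<i) = ≺-trans (π-mono j<i) πi≺ρi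
    πj≺ρi (inj₂ j≡i) = subst (λ h → (π ⟨$⟩ʳ h) ≺ _) (sym (Fin.toℕ-injective j≡i)) πi≺ρi

    no-pivot : ∀ {j} → let k = ρ ⟨$⟩ˡ (π ⟨$⟩ʳ j) in
                  j < i ⊎ toℕ j ≡ toℕ i → ¬ (i < k ⊎ toℕ i ≡ toℕ k)
    no-pivot j≤i (inj₁ i<k) =
      asym (πj≺ρi j≤i) (subst (_ ≺_) (inverseʳ ρ) (ρ-mono i<k))
    no-pivot j≤i (inj₂ i≡k) =
      irrefl (trans (sym (inverseʳ ρ)) (cong (ρ ⟨$⟩ʳ_) (sym (Fin.toℕ-injective i≡k)))) (πj≺ρi j≤i)

  sorted-unique : ∀ (π ρ : Permutation′ n) → (π ⟨$⟩ʳ_) Preserves _<_ ⟶ _≺_ →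
                  (ρ ⟨$⟩ʳ_) Preserves _<_ ⟶ _≺_ → (π ⟨$⟩ʳ_) ≗ (ρ ⟨$⟩ʳ_)
  sorted-unique π ρ π-mono ρ-mono i with compare (π ⟨$⟩ʳ i) (ρ ⟨$⟩ʳ i)
  ... | tri< p _ _  = contradiction p (sorted-minimal π ρ π-mono ρ-mono i)
  ... | tri≈ _ eq _ = eq
  ... | tri> _ _ q  = contradiction q (sorted-minimal ρ π ρ-mono π-mono i)

-- Leader maps and the orders they induce.

-- r sends each element to the greatest element of its block, its leader.
IsLeaderMap : (Fin n → Fin n) → Set
IsLeaderMap r = (∀ i → i ≤ r i) × (∀ i → r (r i) ≡ r i)

LeaderMap : ℕ → Setoid 0ℓ 0ℓ
LeaderMap n = On.setoid {B = Σ[ r ∈ (Fin n → Fin n) ] IsLeaderMap r} (Fin n →-setoid Fin n) proj₁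

-- Blocks in increasing order of leaders, each listed as its leader followed
-- by the other elements in increasing order.
Before : (Fin n → Fin n) → Rel (Fin n) 0ℓ
Before r x y = r x < r y ⊎ (r x ≡ r y × y ≢ r y × (x ≡ r x ⊎ x < y))

module _ {r : Fin n → Fin n} where
  before⇒≤ : ∀ {x y} → Before r x y → r x ≤ r y
  before⇒≤ (inj₁ rx<ry)       = ℕ.<⇒≤ rx<ry
  before⇒≤ (inj₂ (rx≡ry , _)) = Fin.≤-reflexive rx≡ry

  before-irrefl : Irreflexive _≡_ (Before r)
  before-irrefl refl (inj₁ rx<rx)                 = ℕ.<-irrefl refl rx<rx
  before-irrefl refl (inj₂ (_ , x≢rx , inj₁ x≡rx)) = x≢rx x≡rx
  before-irrefl refl (inj₂ (_ , _ , inj₂ x<x))     = ℕ.<-irrefl refl x<x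

  before-trans : Transitive (Before r)
  before-trans (inj₁ p) q = inj₁ (ℕ.<-≤-trans p (before⇒≤ q))
  before-trans p (inj₁ q) = inj₁ (ℕ.≤-<-trans (before⇒≤ p) q)
  before-trans (inj₂ (_ , y≢ry , _)) (inj₂ (_ , _ , inj₁ y≡ry)) = contradiction y≡ry y≢ry
  before-trans (inj₂ (rx≡ry , _ , inj₁ x≡rx)) (inj₂ (ry≡rz , z≢rz , _)) =
    inj₂ (trans rx≡ry ry≡rz , z≢rz , inj₁ x≡rx)
  before-trans (inj₂ (rx≡ry , _ , inj₂ x<y)) (inj₂ (ry≡rz , z≢rz , inj₂ y<z)) =
    inj₂ (trans rx≡ry ry≡rz , z≢rz , inj₂ (ℕ.<-trans x<y y<z))

  before-connex : ∀ {x y} → x ≢ y → Before r x y ⊎ Before r y x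
  before-connex {x} {y} x≢y with Fin.<-cmp (r x) (r y)
  ... | tri< rx<ry _ _ = inj₁ (inj₁ rx<ry)
  ... | tri> _ _ ry<rx = inj₂ (inj₁ ry<rx)
  ... | tri≈ _ rx≡ry _ with x Fin.≟ r x | y Fin.≟ r y
  ...   | yes x≡rx | yes y≡ry = contradiction (trans x≡rx (trans rx≡ry (sym y≡ry))) x≢y
  ...   | yes x≡rx | no y≢ry  = inj₁ (inj₂ (rx≡ry , y≢ry , inj₁ x≡rx))
  ...   | no x≢rx  | yes y≡ry = inj₂ (inj₂ (sym rx≡ry , x≢rx , inj₁ y≡ry))
  ...   | no x≢rx  | no y≢ry with Fin.<-cmp x y
  ...     | tri< x<y _ _ = inj₁ (inj₂ (rx≡ry , y≢ry , inj₂ x<y))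
  ...     | tri≈ _ x≡y _ = contradiction x≡y x≢y
  ...     | tri> _ _ y<x = inj₂ (inj₂ (sym rx≡ry , x≢rx , inj₂ y<x))

  before-asym : ∀ {x y} → Before r x y → ¬ Before r y x
  before-asym p q = before-irrefl refl (before-trans p q)

  before-compare : Trichotomous _≡_ (Before r)
  before-compare x y with x Fin.≟ y
  ... | yes refl = tri≈ (before-irrefl refl) refl (before-irrefl refl)
  ... | no x≢y with before-connex x≢y
  ...   | inj₁ p = tri< p x≢y (before-asym p)
  ...   | inj₂ q = tri> (before-asym q) x≢y q

  before-isStrictTotalOrder : IsStrictTotalOrder _≡_ (Before r)
  before-isStrictTotalOrder = record
    { isStrictPartialOrder = record
      { isEquivalence = isEquivalence
      ; irrefl        = before-irrefl
      ; trans         = before-trans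
      ; <-resp-≈      = resp₂ (Before r)
      }
    ; compare = before-compare
    }

before-cong : ∀ {r s : Fin n → Fin n} → r ≗ s → ∀ {x y} → Before r x y → Before s x y
before-cong r≗s (inj₁ rx<ry) = inj₁ (subst₂ _<_ (r≗s _) (r≗s _) rx<ry)
before-cong r≗s (inj₂ (rx≡ry , y≢ry , p)) = inj₂
  ( trans (sym (r≗s _)) (trans rx≡ry (r≗s _))
  , (λ y≡sy → y≢ry (trans y≡sy (sym (r≗s _))))
  , map₁ (λ x≡rx → trans x≡rx (r≗s _)) p )

Sorted : (Fin n → Fin n) → (Fin n → Fin n) → Set
Sorted r f = f Preserves _<_ ⟶ Before r

-- Permutations and leader maps

module _ (π : Permutation′ n) where
  UpTo : Fin n → Pred (Fin n) 0ℓ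
  UpTo x y = π ⟨$⟩ˡ y ≤ π ⟨$⟩ˡ x

  leader-exists : ∀ x → ∃ (IsGreatest (UpTo x))
  leader-exists x = greatest (λ y → π ⟨$⟩ˡ y ≤? π ⟨$⟩ˡ x) (x , ℕ.≤-refl)

  -- The greatest entry of the word up to `x` is the last left-to-right maximum reached, hence the
  -- entry that opens the cycle of `x` in `hat π`. The definition by prefixes gives the block maxima
  -- without handling cycles.
  leader : Fin n → Fin n
  leader = proj₁ ∘ leader-exists

  leader-isGreatest : ∀ x → IsGreatest (UpTo x) (leader x)
  leader-isGreatest = proj₂ ∘ leader-exists

  leader-isLeaderMap : IsLeaderMap leader
  leader-isLeaderMap = inflationary , idempotent
    where
    inflationary : ∀ x → x ≤ leader x
    inflationary x = proj₂ (leader-isGreatest x) ℕ.≤-refl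

    idempotent : ∀ x → leader (leader x) ≡ leader x
    -- The prefix ending at `leader x` is contained in the prefix ending at `x`.
    idempotent x = Fin.≤-antisym
      (proj₂ (leader-isGreatest x)
        (ℕ.≤-trans (proj₁ (leader-isGreatest (leader x))) (proj₁ (leader-isGreatest x))))
      (inflationary (leader x))

  leader-mono : ∀ {x y} → π ⟨$⟩ˡ x ≤ π ⟨$⟩ˡ y → leader x ≤ leader y
  leader-mono {x} {y} x≤y =
    proj₂ (leader-isGreatest y) (ℕ.≤-trans (proj₁ (leader-isGreatest x)) x≤y)

  leader-attained : ∀ j → ∃[ p ] p ≤ j × π ⟨$⟩ʳ p ≡ leader (π ⟨$⟩ʳ j)
  leader-attained j =
    π ⟨$⟩ˡ leader (π ⟨$⟩ʳ j) ,
    subst (π ⟨$⟩ˡ leader (π ⟨$⟩ʳ j) ≤_) (inverseˡ π) (proj₁ (leader-isGreatest (π ⟨$⟩ʳ j))) ,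
    inverseʳ π

  -- The leader of the entry at `i` occupies a position at most `i`. This is why the later of two
  -- entries of one block is never its leader.
  leader-earlier : ∀ {i j} → i < j → π ⟨$⟩ʳ j ≢ leader (π ⟨$⟩ʳ i)
  leader-earlier {i} i<j eq with p , p≤i , eq′ ← leader-attained i
    with refl ← permutation-injective π (trans eq (sym eq′)) = ℕ.<⇒≱ i<j p≤i

  leader-least : ∀ {j} {x : Fin n} → (∀ {k} → k ≤ j → π ⟨$⟩ʳ k ≤ x) → leader (π ⟨$⟩ʳ j) ≤ x
  leader-least {j} {x} ub with p , p≤j , eq ← leader-attained j = subst (_≤ x) eq (ub p≤j)

⋖⇒< : ∀ {i j : Fin n} → i ⋖ j → i < j
⋖⇒< = ℕ.≤-reflexive

module _ (π : Permutation′ n) (records : DescentTopsAreRecords (π ⟨$⟩ʳ_)) where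
  private
    f = π ⟨$⟩ʳ_
    ℓ = leader π

  -- Otherwise `f i` is a descent top, so a record, so its own leader.
  ascent-in-block : ∀ {i j} → i ⋖ j → f i ≢ ℓ (f i) → f i < f j
  ascent-in-block {i} {j} i⋖j fi≢ with Fin.<-cmp (f i) (f j)
  ... | tri< fi<fj _ _ = fi<fj
  ... | tri≈ _ fi≡fj _ = contradiction (⋖⇒< i⋖j) (Fin.<-irrefl (permutation-injective π fi≡fj))
  ... | tri> _ _ fj<fi = contradiction
    (Fin.≤-antisym (proj₁ (leader-isLeaderMap π) (f i)) (leader-least π ub)) fi≢
    where
    ub : ∀ {k} → k ≤ i → f k ≤ f i
    ub k≤i with ℕ.m≤n⇒m<n∨m≡n k≤i
    ... | inj₁ k<i = records i⋖j fj<fi k<i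
    ... | inj₂ k≡i = Fin.≤-reflexive (cong f (Fin.toℕ-injective k≡i))

leader-position-mono : ∀ (π : Permutation′ n) {i j} → i ≤ j →
                       leader π (π ⟨$⟩ʳ i) ≤ leader π (π ⟨$⟩ʳ j)
leader-position-mono π i≤j = leader-mono π (subst₂ _≤_ (sym (inverseˡ π)) (sym (inverseˡ π)) i≤j)

-- Induction on `j`. Leaders grow weakly along the word, so every position between `i` and `j` has
-- the same leader; by `leader-earlier` none of them holds it, and `ascent-in-block` applies at each
-- step.
increasing-in-block : ∀ (π : Permutation′ n) → DescentTopsAreRecords (π ⟨$⟩ʳ_) →
  ∀ i j → i < j → leader π (π ⟨$⟩ʳ i) ≡ leader π (π ⟨$⟩ʳ j) →
  π ⟨$⟩ʳ i ≢ leader π (π ⟨$⟩ʳ i) → π ⟨$⟩ʳ i < π ⟨$⟩ʳ j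
increasing-in-block {n = suc n} π records i j i<j ℓi≡ℓj fi≢ =
  <-weakInduction P (λ ()) step j i<j ℓi≡ℓj
  where
  f = π ⟨$⟩ʳ_
  ℓ = leader π

  P : Fin (suc n) → Set
  P j = i < j → ℓ (f i) ≡ ℓ (f j) → f i < f j

  step : ∀ k → P (inject₁ k) → P (suc k)
  step k IH i<1+k ℓi≡ℓ with ℕ.m≤n⇒m<n∨m≡n i≤k
    where
    i≤k : i ≤ inject₁ k
    i≤k = subst (toℕ i ℕ.≤_) (sym (Fin.toℕ-inject₁ k)) (ℕ.≤-pred i<1+k)
  ... | inj₂ i≡k = ascent-in-block π records (cong suc (trans i≡k (Fin.toℕ-inject₁ k))) fi≢
  ... | inj₁ i<k = ℕ.<-trans (IH i<k ℓi≡ℓk)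
                     (ascent-in-block π records k⋖1+k λ fk≡ → leader-earlier π i<k (trans fk≡ (sym ℓi≡ℓk)))
    where
    k⋖1+k : inject₁ k ⋖ suc k
    k⋖1+k = cong suc (Fin.toℕ-inject₁ k)

    ℓi≡ℓk : ℓ (f i) ≡ ℓ (f (inject₁ k))
    ℓi≡ℓk = Fin.≤-antisym (leader-position-mono π (ℕ.<⇒≤ i<k))
      (subst (_ ≤_) (sym ℓi≡ℓ) (leader-position-mono π (ℕ.<⇒≤ (⋖⇒< k⋖1+k))))

-- Leaders grow weakly along the word. On a tie, `leader-earlier` shows that the later entry is not
-- the leader, and `increasing-in-block` orders the entries other than the leader.
leader-sorted : ∀ (π : Permutation′ n) → DescentTopsAreRecords (π ⟨$⟩ʳ_) →
                Sorted (leader π) (π ⟨$⟩ʳ_)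
leader-sorted π records {i} {j} i<j with ℕ.m≤n⇒m<n∨m≡n (leader-position-mono π (ℕ.<⇒≤ i<j))
... | inj₁ ℓi<ℓj = inj₁ ℓi<ℓj
... | inj₂ ℓi≡ℓj = inj₂ (ℓi≡ℓj′ , (λ fj≡ → leader-earlier π i<j (trans fj≡ (sym ℓi≡ℓj′))) , first)
  where
  ℓi≡ℓj′ = Fin.toℕ-injective ℓi≡ℓj

  first : π ⟨$⟩ʳ i ≡ leader π (π ⟨$⟩ʳ i) ⊎ π ⟨$⟩ʳ i < π ⟨$⟩ʳ j
  first with π ⟨$⟩ʳ i Fin.≟ leader π (π ⟨$⟩ʳ i)
  ... | yes fi≡ = inj₁ fi≡
  ... | no fi≢  = inj₂ (increasing-in-block π records i j i<j ℓi≡ℓj′ fi≢)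

module _ {r : Fin n → Fin n} (isLeaderMap : IsLeaderMap r)
         (π : Permutation′ n) (sorted : Sorted r (π ⟨$⟩ʳ_)) where
  private
    f = π ⟨$⟩ʳ_
    inflationary = proj₁ isLeaderMap
    idempotent   = proj₂ isLeaderMap

  sorted-position : ∀ {x y} → π ⟨$⟩ˡ x < π ⟨$⟩ˡ y → Before r x y
  sorted-position x<y = subst₂ (Before r) (inverseʳ π) (inverseʳ π) (sorted x<y)

  sorted-mono : ∀ {x y} → π ⟨$⟩ˡ x ≤ π ⟨$⟩ˡ y → r x ≤ r y
  sorted-mono {x} {y} x≤y with ℕ.m≤n⇒m<n∨m≡n x≤y
  ... | inj₁ x<y = before⇒≤ (sorted-position x<y)
  ... | inj₂ x≡y = Fin.≤-reflexive
    (cong r (permutation-injective (flip π) (Fin.toℕ-injective x≡y)))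

  -- No `x` comes before `r x` in the order, so `r x` lies in the prefix of `x`; and each `y` in
  -- that prefix satisfies `y ≤ r y ≤ r x`.
  sorted⇒isGreatest : ∀ x → IsGreatest (UpTo π x) (r x)
  sorted⇒isGreatest x =
    ℕ.≮⇒≥ (λ x<rx → not-before (sorted-position x<rx)) ,
    λ y≤x → ℕ.≤-trans (inflationary _) (sorted-mono y≤x)
    where
    not-before : ¬ Before r x (r x)
    not-before (inj₁ rx<rrx)         = Fin.<-irrefl (sym (idempotent x)) rx<rrx
    not-before (inj₂ (_ , rx≢rrx , _)) = rx≢rrx (sym (idempotent x))

  sorted⇒leader : leader π ≗ r
  sorted⇒leader x = greatest-unique id id (leader-isGreatest π x) (sorted⇒isGreatest x)

  -- If `f i` is its own leader, every earlier entry satisfies `f k ≤ r (f k) ≤ r (f i) = f i`. If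
  -- it is not, no descent can occur at `i`.
  sorted⇒descentTopsAreRecords : DescentTopsAreRecords f
  sorted⇒descentTopsAreRecords {i} {j} {k} i⋖j fj<fi k<i with f i Fin.≟ r (f i)
  ... | yes fi≡ = subst (f k ≤_) (sym fi≡)
                    (ℕ.≤-trans (inflationary (f k)) (before⇒≤ {r = r} (sorted k<i)))
  ... | no fi≢ with sorted (⋖⇒< i⋖j)
  ...   | inj₂ (_ , _ , inj₁ fi≡)   = contradiction fi≡ fi≢
  ...   | inj₂ (_ , _ , inj₂ fi<fj) = contradiction fi<fj (ℕ.<-asym fj<fi)
  -- The block changes between `i` and `j`. Since `f j` lies below its leader, that leader stands
  -- before `j`, so at or before `i`, although `r` grows weakly along the word and
  -- `r (f i) < r (f j)`.
  ...   | inj₁ ri<rj = contradiction (subst (_≤ r (f i)) (idempotent (f j)) (sorted-mono p≤i)) (ℕ.<⇒≱ ri<rj)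
    where
    p = π ⟨$⟩ˡ r (f j)

    fj<rj : f j < r (f j)
    fj<rj = ℕ.<-trans fj<fi (ℕ.≤-<-trans (inflationary (f i)) ri<rj)

    p≤j : p ≤ j
    p≤j = subst (p ≤_) (inverseˡ π) (proj₁ (sorted⇒isGreatest (f j)))

    p≢j : toℕ p ≢ toℕ j
    p≢j p≡j = Fin.<-irrefl (trans (cong f (sym (Fin.toℕ-injective p≡j))) (inverseʳ π)) fj<rj

    p≤i : p ≤ π ⟨$⟩ˡ f i
    p≤i = subst (p ≤_) (sym (inverseˡ π))
            (ℕ.≤-pred (subst (toℕ p ℕ.<_) (sym i⋖j) (ℕ.≤∧≢⇒< p≤j p≢j)))

-- Equality in `𝒮` compares forward maps only, while `leader` compares positions, that is, values of
-- the inverse map.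
⟨$⟩ˡ-cong : ∀ (π ρ : Permutation′ n) → (π ⟨$⟩ʳ_) ≗ (ρ ⟨$⟩ʳ_) → (π ⟨$⟩ˡ_) ≗ (ρ ⟨$⟩ˡ_)
⟨$⟩ˡ-cong π ρ π≗ρ x = permutation-injective ρ
  (trans (sym (π≗ρ (π ⟨$⟩ˡ x))) (trans (inverseʳ π) (sym (inverseʳ ρ))))

leader-cong : ∀ (π ρ : Permutation′ n) → (π ⟨$⟩ʳ_) ≗ (ρ ⟨$⟩ʳ_) → leader π ≗ leader ρ
leader-cong π ρ π≗ρ x = greatest-unique
  (subst₂ _≤_ (⟨$⟩ˡ-cong π ρ π≗ρ _) (⟨$⟩ˡ-cong π ρ π≗ρ _))
  (subst₂ _≤_ (sym (⟨$⟩ˡ-cong π ρ π≗ρ _)) (sym (⟨$⟩ˡ-cong π ρ π≗ρ _)))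
  (leader-isGreatest π x) (leader-isGreatest ρ x)

-- The bijection between avoiders and leader maps.

sortBy : (Fin n → Fin n) → Permutation′ n
sortBy r = sort (before-isStrictTotalOrder {r = r})

sortBy-sorted : ∀ (r : Fin n → Fin n) → Sorted r (sortBy r ⟨$⟩ʳ_)
sortBy-sorted r = sort-mono (before-isStrictTotalOrder {r = r})

-- With `r` and `s` only pointwise equal, this serves both as congruence of `sortBy` and as the
-- round trip from permutations.
sortBy-unique : ∀ {r s : Fin n → Fin n} → r ≗ s → ∀ (π : Permutation′ n) →
                Sorted s (π ⟨$⟩ʳ_) → (sortBy r ⟨$⟩ʳ_) ≗ (π ⟨$⟩ʳ_)
sortBy-unique {r = r} {s} r≗s π sorted =
  sorted-unique (before-isStrictTotalOrder {r = s}) (sortBy r) π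
    (before-cong r≗s ∘ sortBy-sorted r) sorted

avoiders↔leaderMaps : ∀ n → Inverse (𝒮 n 32,2→1) (LeaderMap n)
avoiders↔leaderMaps n = record
  { to        = λ (π , _) → leader π , leader-isLeaderMap π
  ; from      = λ (r , isLM) → sortBy r ,
                  descentTopsAreRecords⇒avoids (sortBy r)
                    (sorted⇒descentTopsAreRecords isLM (sortBy r) (sortBy-sorted r))
  ; to-cong   = λ { {π , _} {ρ , _} → leader-cong π ρ }
  ; from-cong = λ { {r , _} {s , _} r≗s → sortBy-unique r≗s (sortBy s) (sortBy-sorted s) }
  ; inverse   =
      -- Each half of `inverse` starts from an element that merely equals, in the setoid, an image
      -- under the opposite map; hence `leader-cong`.
      (λ { {r , isLM} {π , _} π≗ x → trans (leader-cong π (sortBy r) π≗ x)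
             (sorted⇒leader isLM (sortBy r) (sortBy-sorted r) x) })
    , (λ { {π , av} {r , _} r≗ →
             sortBy-unique r≗ π (leader-sorted π (avoids⇒descentTopsAreRecords π av)) })
  }

-- Two facts about lists.

lookup-injective : ∀ {xs : List A} → Unique xs → ∀ {i j} → lookup xs i ≡ lookup xs j → i ≡ j
lookup-injective (_ ∷ _)   {zero}  {zero}  _  = refl
lookup-injective (x≢ ∷ _) {zero}  {suc j} eq = contradiction eq (All.lookup x≢ (∈-lookup j))
lookup-injective (x≢ ∷ _) {suc i} {zero}  eq = contradiction (sym eq) (All.lookup x≢ (∈-lookup i))
lookup-injective (_ ∷ u)   {suc i} {suc j} eq = cong suc (lookup-injective u eq)

-- Distinct subsets become disjoint only once both are known to be fibres, so the map on pairs must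
-- see `P` at both entries.
allPairs-mapWith : ∀ {P : Pred A 0ℓ} {R S : Rel A 0ℓ} → (∀ {x y} → P x → P y → R x y → S x y) →
                   ∀ {xs} → All P xs → AllPairs R xs → AllPairs S xs
allPairs-mapWith f []         []         = []
allPairs-mapWith f (Px ∷ Pxs) (Rx ∷ Rxs) =
  All.zipWith (λ (Py , Rxy) → f Px Py Rxy) (Pxs , Rx) ∷ allPairs-mapWith f Pxs Rxs

-- Set partitions and leader maps

∈-sublists⇒⊆ : ∀ {xs ys : List A} → ys ∈ sublists xs → ys List.⊆ xs
∈-sublists⇒⊆ {xs = []} (here refl) ()
∈-sublists⇒⊆ {xs = x ∷ xs} ys∈ z∈ys with ∈-++⁻ (sublists xs) ys∈
... | inj₁ p = there (∈-sublists⇒⊆ p z∈ys)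
... | inj₂ q with zs , p , refl ← ∈-map⁻ (x ∷_) q with z∈ys
...   | here z≡x  = here z≡x
...   | there z∈zs = there (∈-sublists⇒⊆ p z∈zs)

filter-∈-sublists : ∀ {P : Pred A 0ℓ} (P? : Decidable P) xs → filter P? xs ∈ sublists xs
filter-∈-sublists P? []       = here refl
filter-∈-sublists P? (x ∷ xs) with P? x
... | yes _ = ∈-++⁺ʳ (sublists xs) (∈-map⁺ (x ∷_) (filter-∈-sublists P? xs))
... | no _  = ∈-++⁺ˡ (filter-∈-sublists P? xs)

sublists-unique : ∀ {xs : List A} → Unique xs → Unique (sublists xs)
sublists-unique []              = [] ∷ []
sublists-unique {xs = x ∷ xs} u@(_ ∷ u′) =
  ++⁺ (sublists-unique u′) (map⁺ (λ { refl → refl }) (sublists-unique u′)) disjoint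
  where
  disjoint : ∀ {ys} → ¬ (ys ∈ sublists xs × ys ∈ map (x ∷_) (sublists xs))
  disjoint (p , q) with _ , _ , refl ← ∈-map⁻ (x ∷_) q =
    Unique[x∷xs]⇒x∉xs u (∈-sublists⇒⊆ p (here refl))

-- A sublist inherits the order of the repetition-free `zs`, so its set of entries determines it.
-- Equality of families then reduces to mutual inclusion.
sublists-antisym : ∀ {xs ys zs : List A} → Unique zs → xs ∈ sublists zs → ys ∈ sublists zs →
                   xs List.⊆ ys → ys List.⊆ xs → xs ≡ ys
sublists-antisym {zs = []} u (here refl) (here refl) _ _ = refl
sublists-antisym {zs = z ∷ zs} u@(_ ∷ u′) xs∈ ys∈ xs⊆ys ys⊆xs
  with ∈-++⁻ (sublists zs) xs∈ | ∈-++⁻ (sublists zs) ys∈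
... | inj₁ p | inj₁ q = sublists-antisym u′ p q xs⊆ys ys⊆xs
... | inj₁ p | inj₂ q with _ , _ , refl ← ∈-map⁻ (z ∷_) q =
  contradiction (∈-sublists⇒⊆ p (ys⊆xs (here refl))) (Unique[x∷xs]⇒x∉xs u)
... | inj₂ p | inj₁ q with _ , _ , refl ← ∈-map⁻ (z ∷_) p =
  contradiction (∈-sublists⇒⊆ q (xs⊆ys (here refl))) (Unique[x∷xs]⇒x∉xs u)
... | inj₂ p | inj₂ q with _ , p′ , refl ← ∈-map⁻ (z ∷_) p | _ , q′ , refl ← ∈-map⁻ (z ∷_) q =
  cong (z ∷_) (sublists-antisym u′ p′ q′ (strip p′ xs⊆ys) (strip q′ ys⊆xs))
  where
  strip : ∀ {vs ws} → vs ∈ sublists zs → z ∷ vs List.⊆ z ∷ ws → vs List.⊆ ws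
  strip p vs⊆ws v∈vs with vs⊆ws (there v∈vs)
  ... | here refl  = contradiction (∈-sublists⇒⊆ p v∈vs) (Unique[x∷xs]⇒x∉xs u)
  ... | there v∈ws = v∈ws

∈-subsets : ∀ (S : Subset n) → S ∈ subsets n
∈-subsets Vec.[]                        = here refl
∈-subsets {n = suc n} (outside Vec.∷ S) = ∈-++⁺ˡ (∈-map⁺ _ (∈-subsets S))
∈-subsets {n = suc n} (inside Vec.∷ S)  = ∈-++⁺ʳ (map _ (subsets n)) (∈-map⁺ _ (∈-subsets S))

subsets-unique : ∀ n → Unique (subsets n)
subsets-unique zero    = [] ∷ []
subsets-unique (suc n) = ++⁺ (map⁺ Vec.∷-injectiveʳ (subsets-unique n))
                             (map⁺ Vec.∷-injectiveʳ (subsets-unique n)) disjoint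
  where
  disjoint : ∀ {S} → ¬ (S ∈ map (outside Vec.∷_) (subsets n) × S ∈ map (inside Vec.∷_) (subsets n))
  disjoint (p , q) with _ , _ , refl ← ∈-map⁻ (outside Vec.∷_) p with () ← proj₂ (proj₂ (∈-map⁻ _ q))

setPartitions-unique : ∀ n → Unique (setPartitions n)
setPartitions-unique n = filter⁺ isSetPartition? (sublists-unique (subsets-unique n))

-- The set partition into the fibres of a map.

fiber : (Fin n → Fin n) → Fin n → Subset n
fiber r x = subsetOf (λ y → r y Fin.≟ r x)

∈-fiber⁺ : ∀ (r : Fin n → Fin n) {x y} → r y ≡ r x → y ∈ₛ fiber r x
∈-fiber⁺ r {x} = ∈-subsetOf⁺ (λ y → r y Fin.≟ r x)

∈-fiber⁻ : ∀ (r : Fin n → Fin n) {x y} → y ∈ₛ fiber r x → r y ≡ r x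
∈-fiber⁻ r {x} = ∈-subsetOf⁻ (λ y → r y Fin.≟ r x)

IsFiber : (Fin n → Fin n) → Pred (Subset n) 0ℓ
IsFiber r S = ∃[ x ] S ≡ fiber r x

isFiber? : ∀ (r : Fin n → Fin n) → Decidable (IsFiber r)
isFiber? r S = Fin.any? (λ x → Vec.≡-dec Bool._≟_ S (fiber r x))

-- Filtering `subsets` lists each fibre once and in the standard order, which makes the result
-- literally an entry of `setPartitions`.
fibers : (Fin n → Fin n) → List (Subset n)
fibers r = filter (isFiber? r) (subsets _)

fiber-∈-fibers : ∀ (r : Fin n → Fin n) x → fiber r x ∈ fibers r
fiber-∈-fibers r x = ∈-filter⁺ (isFiber? r) (∈-subsets _) (x , refl)

∈-fibers⁻ : ∀ (r : Fin n → Fin n) {S} → S ∈ fibers r → IsFiber r S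
∈-fibers⁻ r = proj₂ ∘ ∈-filter⁻ (isFiber? r) {xs = subsets _}

fibers-isSetPartition : ∀ (r : Fin n → Fin n) → IsSetPartition (fibers r)
fibers-isSetPartition {n} r =
  All.map (λ { (x , refl) → x , ∈-fiber⁺ r refl }) allFibers ,
  allPairs-mapWith disjoint allFibers (filter⁺ (isFiber? r) (subsets-unique n)) ,
  λ i → lose (fiber-∈-fibers r i) (∈-fiber⁺ r refl)
  where
  allFibers : All (IsFiber r) (fibers r)
  allFibers = All.all-filter (isFiber? r) (subsets n)

  disjoint : ∀ {S T} → IsFiber r S → IsFiber r T → S ≢ T → Empty (S ∩ T)
  disjoint (x , refl) (y , refl) S≢T (z , z∈) with z∈S , z∈T ← x∈p∩q⁻ _ _ z∈ =
    S≢T (⊆-antisym (λ w∈ → ∈-fiber⁺ r (trans (∈-fiber⁻ r w∈) rx≡ry))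
                   (λ w∈ → ∈-fiber⁺ r (trans (∈-fiber⁻ r w∈) (sym rx≡ry))))
    where
    rx≡ry : r x ≡ r y
    rx≡ry = trans (sym (∈-fiber⁻ r z∈S)) (∈-fiber⁻ r z∈T)

fibers-∈-setPartitions : ∀ (r : Fin n → Fin n) → fibers r ∈ setPartitions n
fibers-∈-setPartitions r = ∈-filter⁺ isSetPartition?
  (filter-∈-sublists (isFiber? r) (subsets _)) (fibers-isSetPartition r)

≡-fibers : ∀ {F : List (Subset n)} (r : Fin n → Fin n) → F ∈ setPartitions n →
           (∀ {S} → S ∈ F → IsFiber r S) → (∀ x → fiber r x ∈ F) → F ≡ fibers r
≡-fibers {n} r F∈ F⊆ ⊆F = sublists-antisym (subsets-unique n)
  (proj₁ (∈-filter⁻ isSetPartition? {xs = sublists (subsets n)} F∈)) (filter-∈-sublists (isFiber? r) (subsets n))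
  (λ S∈F → ∈-filter⁺ (isFiber? r) (∈-subsets _) (F⊆ S∈F))
  (λ S∈ → let x , eq = ∈-fibers⁻ r S∈ in subst (_∈ _) (sym eq) (⊆F x))

-- The leader map of a set partition.

SameBlock : List (Subset n) → Fin n → Pred (Fin n) 0ℓ
SameBlock F x y = Any (λ S → x ∈ₛ S × y ∈ₛ S) F

sameBlock? : ∀ (F : List (Subset n)) x → Decidable (SameBlock F x)
sameBlock? F x y = any? (λ S → x ∈? S ×-dec y ∈? S) F

sameBlock-sym : ∀ {F : List (Subset n)} {x y} → SameBlock F x y → SameBlock F y x
sameBlock-sym = Any.map swap

module _ {F : List (Subset n)} (isSP : IsSetPartition F) where
  blocks-meet : ∀ {S T x} → S ∈ F → T ∈ F → x ∈ₛ S → x ∈ₛ T → S ≡ T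
  blocks-meet S∈F T∈F x∈S x∈T with ∈-AllPairs₂ (proj₁ (proj₂ isSP)) S∈F T∈F
  ... | inj₁ S≡T           = S≡T
  ... | inj₂ (inj₁ S∩T=∅) = contradiction (_ , x∈p∩q⁺ (x∈S , x∈T)) S∩T=∅
  ... | inj₂ (inj₂ T∩S=∅) = contradiction (_ , x∈p∩q⁺ (x∈T , x∈S)) T∩S=∅

  sameBlock-refl : ∀ x → SameBlock F x x
  sameBlock-refl x = Any.map (λ x∈S → x∈S , x∈S) (proj₂ (proj₂ isSP) x)

  sameBlock⇒∈ : ∀ {S x y} → S ∈ F → x ∈ₛ S → SameBlock F x y → y ∈ₛ S
  sameBlock⇒∈ {y = y} S∈F x∈S x~y with T , T∈F , x∈T , y∈T ← find x~y =
    subst (y ∈ₛ_) (blocks-meet T∈F S∈F x∈T x∈S) y∈T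

  sameBlock-trans : ∀ {x y z} → SameBlock F x y → SameBlock F y z → SameBlock F x z
  sameBlock-trans x~y y~z with S , S∈F , x∈S , y∈S ← find x~y =
    lose S∈F (x∈S , sameBlock⇒∈ S∈F y∈S y~z)

  blockMax-exists : ∀ x → ∃ (IsGreatest (SameBlock F x))
  blockMax-exists x = greatest (sameBlock? F x) (x , sameBlock-refl x)

  blockMax : Fin n → Fin n
  blockMax = proj₁ ∘ blockMax-exists

  blockMax-isGreatest : ∀ x → IsGreatest (SameBlock F x) (blockMax x)
  blockMax-isGreatest = proj₂ ∘ blockMax-exists

  blockMax-sameBlock : ∀ x → SameBlock F x (blockMax x)
  blockMax-sameBlock = proj₁ ∘ blockMax-isGreatest

  sameBlock⇒≡ : ∀ {x y} → SameBlock F x y → blockMax x ≡ blockMax y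
  sameBlock⇒≡ x~y = greatest-unique (sameBlock-trans (sameBlock-sym x~y)) (sameBlock-trans x~y)
    (blockMax-isGreatest _) (blockMax-isGreatest _)

  ≡⇒sameBlock : ∀ {x y} → blockMax x ≡ blockMax y → SameBlock F x y
  ≡⇒sameBlock {x} {y} eq = sameBlock-trans (blockMax-sameBlock x)
    (subst (λ m → SameBlock F m y) (sym eq) (sameBlock-sym (blockMax-sameBlock y)))

  blockMax-isLeaderMap : IsLeaderMap blockMax
  blockMax-isLeaderMap =
    (λ x → proj₂ (blockMax-isGreatest x) (sameBlock-refl x)) ,
    (λ x → sym (sameBlock⇒≡ (blockMax-sameBlock x)))

  -- Two elements share a block iff their block maxima agree. A pointwise equal `r` replaces
  -- `blockMax` because the setoid of leader maps provides no more.
  block≡fiber : ∀ {r} → r ≗ blockMax → ∀ {S x} → S ∈ F → x ∈ₛ S → S ≡ fiber r x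
  block≡fiber {r} r≗ {S} {x} S∈F x∈S = ⊆-antisym
    (λ y∈S → ∈-fiber⁺ r (trans (r≗ _) (trans (sameBlock⇒≡ (lose S∈F (y∈S , x∈S))) (sym (r≗ _)))))
    (λ y∈ → sameBlock⇒∈ S∈F x∈S
      (≡⇒sameBlock (trans (sym (r≗ _)) (trans (sym (∈-fiber⁻ r y∈)) (r≗ _)))))

  ≡-fibers-blockMax : ∀ {r} → F ∈ setPartitions n → r ≗ blockMax → F ≡ fibers r
  ≡-fibers-blockMax {r} F∈ r≗ = ≡-fibers r F∈ block-isFiber fiber-∈
    where
    block-isFiber : ∀ {S} → S ∈ F → IsFiber r S
    block-isFiber S∈F with x , x∈S ← All.lookup (proj₁ isSP) S∈F = x , block≡fiber r≗ S∈F x∈S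

    fiber-∈ : ∀ x → fiber r x ∈ F
    fiber-∈ x with S , S∈F , x∈S ← find (proj₂ (proj₂ isSP) x) =
      subst (_∈ F) (block≡fiber r≗ S∈F x∈S) S∈F

-- By idempotence `r x` lies in the fibre through `x`, and each `y` in that fibre satisfies
-- `y ≤ r y = r x`.
blockMax-fibers : ∀ {r : Fin n → Fin n} → IsLeaderMap r → ∀ {F} (isSP : IsSetPartition F) →
                  F ≡ fibers r → blockMax isSP ≗ r
blockMax-fibers {r = r} (inflationary , idempotent) isSP refl x =
  greatest-unique id id (blockMax-isGreatest isSP x)
    ( lose (fiber-∈-fibers r x) (∈-fiber⁺ r refl , ∈-fiber⁺ r (idempotent x))
    , upper )
  where
  upper : ∀ {y} → SameBlock (fibers r) x y → y ≤ r x
  upper {y} x~y with S , S∈ , x∈S , y∈S ← find x~y with z , refl ← ∈-fibers⁻ r S∈ =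
    subst (y ≤_) (trans (∈-fiber⁻ r y∈S) (sym (∈-fiber⁻ r x∈S))) (inflationary y)

fibers-cong : ∀ {r s : Fin n → Fin n} → r ≗ s → fibers r ≡ fibers s
fibers-cong {r = r} {s} r≗s = ≡-fibers s (fibers-∈-setPartitions r)
  (map₂ (λ { {x} refl → fiber-cong x }) ∘ ∈-fibers⁻ r)
  (λ x → subst (_∈ fibers r) (fiber-cong x) (fiber-∈-fibers r x))
  where
  fiber-cong : ∀ x → fiber r x ≡ fiber s x
  fiber-cong x = ⊆-antisym
    (λ y∈ → ∈-fiber⁺ s (trans (sym (r≗s _)) (trans (∈-fiber⁻ r y∈) (r≗s _))))
    (λ y∈ → ∈-fiber⁺ r (trans (r≗s _) (trans (∈-fiber⁻ s y∈) (sym (r≗s _)))))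

-- The bijection between leader maps and set partitions, and the count.

setPartition : ∀ (k : Fin (bell n)) → IsSetPartition (lookup (setPartitions n) k)
setPartition {n} k =
  proj₂ (∈-filter⁻ isSetPartition? {xs = sublists (subsets n)} (∈-lookup {xs = setPartitions n} k))

leaderMaps↔setPartitions : ∀ n → Inverse (LeaderMap n) (setoid (Fin (bell n)))
leaderMaps↔setPartitions n = record
  { to        = to
  ; from      = λ k → blockMax (setPartition k) , blockMax-isLeaderMap (setPartition k)
  ; to-cong   = λ { {r , _} {s , _} r≗s → lookup-injective (setPartitions-unique n)
                    (trans (lookup-to r) (trans (fibers-cong r≗s) (sym (lookup-to s)))) }
  ; from-cong = λ { refl _ → refl }
  ; inverse   =
      (λ { {k} {r , _} r≗ → lookup-injective (setPartitions-unique n)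
             (trans (lookup-to r) (sym (≡-fibers-blockMax (setPartition k) (∈-lookup k) r≗))) })
    , (λ { {r , isLM} refl → blockMax-fibers isLM (setPartition _) (lookup-to r) })
  }
  where
  to : Σ[ r ∈ (Fin n → Fin n) ] IsLeaderMap r → Fin (bell n)
  -- The position of `fibers r` in the list. As the list has no repetition, equality of positions
  -- can be tested on the entries there.
  to (r , _) = index (fibers-∈-setPartitions r)

  lookup-to : ∀ r → lookup (setPartitions n) (index (fibers-∈-setPartitions r)) ≡ fibers r
  lookup-to r = sym (lookup-index (fibers-∈-setPartitions r))

theorem6p2 : ∀ (n : ℕ) → n ≥ 1 → HasCardinality (𝒮 n 32,2→1) (bell n)
theorem6p2 n _ = Composition.inverse (avoiders↔leaderMaps n) (leaderMaps↔setPartitions n)
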